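{- If $MA_{\omega_1}(\sigma\text{ -linked})$ holds, then there is no $\Psi$-like space which has property $P_3$.
   Context: $MA_{\omega_1}(\sigma\text{ -linked})$ is the statement: for every $\sigma$-linked partial order $\mathcal{P}$ and every family $\mathcal{D}$ of at most $\omega_1$ dense subsets of $\mathcal{P}$ there is a filter in $\mathcal{P}$ meeting every member of $\mathcal{D}$. (A partial order is $\sigma$-linked if it is a countable union of subsets each consisting of pairwise compatible elements.) A family $\mathcal{A}\subset[\omega]^{\omega}$ of infinite subsets of $\omega$ is almost disjoint if any two distinct members have finite intersection. Given such $\mathcal{A}$, the space $X[\mathcal{A}]$ has underlying set $\omega\cup\mathcal{A}$; the points of $\omega$ are isolated, and a neighborhood base at $A\in\mathcal{A}$ is $\{(A\cup\{A\})\setminus n: n\in\omega\}$, i.e. the sets $\{A\}\cup(A\setminus\{0,\dots,n-1\})$. A topological space is $\Psi$-like if it is homeomorphic to $X[\mathcal{A}]$ for some almost disjoint $\mathcal{A}\subset[\omega]^{\omega}$. A space $X$ has property $P_3$ if it is Hausdorff and, whenever $U_0,U_1,U_2$ are open subsets of $X$ with $U_0\cap U_1\cap U_2=\emptyset$, we have $|U_i|\le\omega$ for some $i<3$.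
   Formalization: The formal theorem excludes only uncountable Ψ-like spaces with property P_3; read literally the claim is false, since every countable Ψ-like space, such as the discrete space ω = X[∅], is Hausdorff and trivially has P_3. -}

module Defs where

open import Data.List.Base using (List)
open import Data.List.Membership.Propositional using () renaming (_∈_ to _∈ˡ_)
open import Data.Fin.Base using (Fin)
open import Data.Nat.Base using (ℕ; _≤_; _⊔_)
open import Data.Nat.Properties using (≤-trans; m≤m⊔n; m≤n⊔m)
open import Data.Product.Base using (Σ; Σ-syntax; ∃-syntax; _×_; _,_; proj₁)
open import Data.Sum.Base using (_⊎_; inj₁; inj₂)
open import Function.Base using (_∘_)
open import Function.Bundles using (Injection; Inverse; _↔_)
open import Induction.WellFounded using (WellFounded)
open import Level using (0ℓ)
open import Relation.Binary.Bundles using (Setoid; Poset; StrictTotalOrder)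
open import Relation.Binary.PropositionalEquality using (_≡_; _≢_; setoid)
import Relation.Binary.Construct.On as On
open import Relation.Nullary.Negation using (¬_)
open import Relation.Unary using (Pred; U; _∈_; _⊆_; _≐_; _∩_; _∪_; ｛_｝; Empty; ⋃; ⋂)

-- Agda has no quotients, so a set is a setoid where one may be needed (the
-- carrier of ω₁, the index set of a family) and a plain type, with _≡_, elsewhere.

------------------------------------------------------------------------
-- Cardinality

Countable : Setoid 0ℓ 0ℓ → Set
Countable S = Injection S (setoid ℕ)

-- Elements of a subset are compared by the underlying element only, never by
-- the membership proof.
restrict : (S : Setoid 0ℓ 0ℓ) → Pred (Setoid.Carrier S) 0ℓ → Setoid 0ℓ 0ℓ
restrict S V = On.setoid {B = Σ (Setoid.Carrier S) V} S proj₁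

CountableSubset : {A : Set} → Pred A 0ℓ → Set
CountableSubset {A} V = Countable (restrict (setoid A) V)

-- W is a copy of ω₁: an uncountable well-order, all of whose proper initial
-- segments are countable.
record IsOmega₁ (W : StrictTotalOrder 0ℓ 0ℓ 0ℓ) : Set where
  open StrictTotalOrder W using (Carrier; _<_; module Eq)
  field
    wellFounded       : WellFounded _<_
    uncountable       : ¬ Countable Eq.setoid
    segment-countable : ∀ w → Countable (restrict Eq.setoid (_< w))

∣_∣≤ω₁ : Setoid 0ℓ 0ℓ → Set₁
∣ I ∣≤ω₁ =
  Σ[ W ∈ StrictTotalOrder 0ℓ 0ℓ 0ℓ ] IsOmega₁ W × Injection I (StrictTotalOrder.Eq.setoid W)

------------------------------------------------------------------------
-- Martin's axiom

-- Forcing convention: smaller elements are stronger conditions.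
module _ (P : Poset 0ℓ 0ℓ 0ℓ) where
  private
    module P = Poset P

  Compatible : P.Carrier → P.Carrier → Set
  Compatible p q = ∃[ r ] r P.≤ p × r P.≤ q

  Linked : Pred P.Carrier 0ℓ → Set
  Linked L = ∀ {p q} → p ∈ L → q ∈ L → Compatible p q

  σ-Linked : Set₁
  σ-Linked = Σ[ L ∈ (ℕ → Pred P.Carrier 0ℓ) ] (∀ n → Linked (L n)) × (U ⊆ ⋃ ℕ L)

  Dense : Pred P.Carrier 0ℓ → Set
  Dense D = ∀ p → ∃[ q ] q P.≤ p × q ∈ D

  record IsFilter (G : Pred P.Carrier 0ℓ) : Set where
    field
      nonempty : ∃[ p ] p ∈ G
      upward   : ∀ {p q} → p ∈ G → p P.≤ q → q ∈ G
      directed : ∀ {p q} → p ∈ G → q ∈ G → ∃[ r ] r ∈ G × r P.≤ p × r P.≤ q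

-- Filters are nonempty, so the partial order must be assumed inhabited.
MAω₁[σ-linked] : Set₁
MAω₁[σ-linked] =
  (P : Poset 0ℓ 0ℓ 0ℓ) → let open Poset P renaming (Carrier to ∣P∣) using () in
  ∣P∣ → σ-Linked P →
  (I : Setoid 0ℓ 0ℓ) → let open Setoid I renaming (Carrier to ∣I∣) in
  ∣ I ∣≤ω₁ →
  (D : ∣I∣ → Pred ∣P∣ 0ℓ) → (∀ {i j} → i ≈ j → D i ≐ D j) → (∀ i → Dense P (D i)) →
  Σ[ G ∈ Pred ∣P∣ 0ℓ ] IsFilter P G × (∀ i → ∃[ p ] p ∈ G × p ∈ D i)

------------------------------------------------------------------------
-- Topological spaces

-- Openness of the empty set is the case I = ⊥ of open-⋃.
record TopologicalSpace : Set₂ where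
  field
    Point     : Set
    Open      : Pred (Pred Point 0ℓ) 0ℓ
    open-resp : ∀ {V W} → V ≐ W → Open V → Open W
    open-U    : Open U
    open-∩    : ∀ {V W} → Open V → Open W → Open (V ∩ W)
    open-⋃    : ∀ {I : Set} {V : I → Pred Point 0ℓ} → (∀ i → Open (V i)) → Open (⋃ I V)

open TopologicalSpace using (Point; Open)

CountableSpace : TopologicalSpace → Set
CountableSpace X = Countable (setoid (Point X))

Continuous : (X Y : TopologicalSpace) → (Point X → Point Y) → Set₁
Continuous X Y f = ∀ {V} → Open Y V → Open X (V ∘ f)

record Homeomorphism (X Y : TopologicalSpace) : Set₁ where
  field
    bijection       : Point X ↔ Point Y
    to-continuous   : Continuous X Y (Inverse.to bijection)
    from-continuous : Continuous Y X (Inverse.from bijection)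

Hausdorff : TopologicalSpace → Set₁
Hausdorff X = ∀ {x y} → x ≢ y →
  Σ[ V ∈ Pred (Point X) 0ℓ ] Σ[ W ∈ Pred (Point X) 0ℓ ]
    Open X V × Open X W × x ∈ V × y ∈ W × Empty (V ∩ W)

P₃ : TopologicalSpace → Set₁
P₃ X = Hausdorff X ×
  ((V : Fin 3 → Pred (Point X) 0ℓ) → (∀ i → Open X (V i)) → Empty (⋂ (Fin 3) V) →
   ∃[ i ] CountableSubset (V i))

------------------------------------------------------------------------
-- Ψ-like spaces

Finite : Pred ℕ 0ℓ → Set
Finite S = Σ[ l ∈ List ℕ ] (∀ {n} → n ∈ S → n ∈ˡ l)

-- The family {set i : i ∈ Index}. Distinct indices give distinct members, an
-- infinite set not being almost disjoint from itself, so Index is in bijection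
-- with the family and stands for it in the space below.
record AlmostDisjointFamily : Set₁ where
  field
    Index           : Set
    set             : Index → Pred ℕ 0ℓ
    infinite        : ∀ i → ¬ Finite (set i)
    almost-disjoint : ∀ {i j} → i ≢ j → Finite (set i ∩ set j)

module _ (𝒜 : AlmostDisjointFamily) where
  open AlmostDisjointFamily 𝒜

  ΨPoint : Set
  ΨPoint = ℕ ⊎ Index

  -- basic x n is {x} when x is isolated, {A} ∪ (A ∖ {0,…,n-1}) when x is the point A.
  basic : ΨPoint → ℕ → Pred ΨPoint 0ℓ
  basic (inj₁ k) n = ｛ inj₁ k ｝
  basic (inj₂ i) n = ｛ inj₂ i ｝ ∪ λ y → ∃[ k ] y ≡ inj₁ k × k ∈ set i × n ≤ k

  ΨOpen : Pred (Pred ΨPoint 0ℓ) 0ℓ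
  ΨOpen V = ∀ {x} → x ∈ V → ∃[ n ] basic x n ⊆ V

  basic-antitone : ∀ x {m n} → m ≤ n → basic x n ⊆ basic x m
  basic-antitone (inj₁ k) m≤n y∈ = y∈
  basic-antitone (inj₂ i) m≤n (inj₁ y≡) = inj₁ y≡
  basic-antitone (inj₂ i) m≤n (inj₂ (k , y≡ , k∈ , n≤k)) =
    inj₂ (k , y≡ , k∈ , ≤-trans m≤n n≤k)

  X[_] : TopologicalSpace
  X[_] = record
    { Point     = ΨPoint
    ; Open      = ΨOpen
    ; open-resp = λ (V⊆W , W⊆V) oV x∈W →
        let n , b⊆V = oV (W⊆V x∈W) in n , λ y∈ → V⊆W (b⊆V y∈)
    ; open-U    = λ _ → 0 , λ _ → _
    ; open-∩    = λ oV oW {x} (x∈V , x∈W) →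
        let m , b⊆V = oV x∈V
            n , b⊆W = oW x∈W
        in m ⊔ n , λ y∈ → b⊆V (basic-antitone x (m≤m⊔n m n) y∈)
                        , b⊆W (basic-antitone x (m≤n⊔m m n) y∈)
    ; open-⋃    = λ oV (i , x∈Vi) →
        let n , b⊆Vi = oV i x∈Vi in n , λ y∈ → i , b⊆Vi y∈
    }

ΨLike : TopologicalSpace → Set₁
ΨLike X = Σ[ 𝒜 ∈ AlmostDisjointFamily ] Homeomorphism X X[ 𝒜 ]

{-# OPTIONS --safe #-}

-- Write e for an injection of ω₁ into the index set of an uncountable Ψ-space.
-- Members of the family are distinguished by their elements, so two of the
-- sets {A : k ∈ A} cut the range of e into three uncountable pieces.
-- Force with finite sets of pairs (A , m), the pair promising that A ∖ m lies in
-- the open set of the piece of A, such that no k is put into all three open sets.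
-- Let n bound all pairwise intersections of members occurring in a condition.
-- Two conditions with the same n and the same traces below n have a common
-- extension: a k ≥ n in all three sets would, by pigeonhole, lie in two members
-- of the same condition. As there are countably many traces, the order is
-- σ-linked, and a generic filter yields open sets contradicting P₃.
module Submission where

open import Defs
open import Axiom.ExcludedMiddle using (ExcludedMiddle)
open import Axiom.Extensionality.Propositional using (Extensionality)
open import Data.Bool.Base using (Bool; true; if_then_else_)
open import Data.Empty using (⊥)
open import Data.Fin.Base using (Fin; zero; suc; toℕ; fromℕ<)
open import Data.Fin.Properties using (toℕ-fromℕ<)
open import Data.List.Base using (List; []; _∷_; _++_)
open import Data.List.Extrema.Nat using (max; xs≤max)
open import Data.List.Membership.Propositional using () renaming (_∈_ to _∈ˡ_)
open import Data.List.Membership.Propositional.Properties using (∈-++⁺ˡ; ∈-++⁺ʳ; ∈-++⁻)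
open import Data.List.Relation.Unary.All using () renaming (lookup to lookupᴬ)
open import Data.List.Relation.Unary.Any using (here; there)
open import Data.Nat.Base using (ℕ; zero; suc; _+_; _⊔_; s≤s) renaming (_≤_ to _≤ⁿ_; _<_ to _<ⁿ_)
open import Data.Nat.Properties using (+-identityʳ; +-suc; m≤m⊔n; m≤n⊔m; <⇒≱)
  renaming (≤-trans to ≤ⁿ-trans)
open import Data.Product.Base using (Σ; Σ-syntax; ∃-syntax; _×_; _,_; proj₁; proj₂)
open import Data.Product.Properties using (,-injective)
open import Data.Sum.Base using (_⊎_; inj₁; inj₂)
import Data.Sum.Base as Sum
open import Data.Sum.Properties using (inj₂-injective)
open import Data.Unit.Base using (tt)
open import Function.Base using (_∘_; id)
open import Function.Bundles using (Injection; Inverse; mk⇔)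
open import Induction.WellFounded using (WellFounded; Acc; acc)
open import Level using (lift; lower; 0ℓ) renaming (suc to lsuc)
open import Relation.Binary.Bundles using (Setoid; Poset; StrictTotalOrder)
import Relation.Binary.Construct.Interior.Symmetric as Sym
open import Relation.Binary.Definitions using (tri<; tri≈; tri>)
open import Relation.Binary.PropositionalEquality using (_≡_; _≢_; refl; sym; trans; cong; subst; setoid)
open import Relation.Nullary.Decidable using (Dec; yes; no; does; map′; decidable-stable; dec-true; does-⇔)
open import Relation.Nullary.Negation using (¬_; contradiction)
open import Relation.Unary using (Pred; U; _∈_; _∉_; _⊆_; _≐_; _∩_; _∪_; ∁; Empty; ⋃; ⋂)

open Sym using (SymInterior; _,_)

-- Enumeration of ℕ × ℕ along antidiagonals

next : ℕ × ℕ → ℕ × ℕ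
next (zero  , b) = suc b , zero
next (suc a , b) = a , suc b

unpair : ℕ → ℕ × ℕ
unpair zero    = 0 , 0
unpair (suc n) = next (unpair n)

private
  -- The antidiagonal starting at `(b + a, 0)` reaches `(a, b)` after `b` steps.
  along : ∀ b a → ∃[ n ] unpair n ≡ (b + a , 0) → ∃[ n ] unpair n ≡ (a , b)
  along zero    a r = r
  along (suc b) a (n , eq)
    with m , eq′ ← along b (suc a) (n , trans eq (cong (_, 0) (sym (+-suc b a)))) =
    suc m , cong next eq′

  -- The antidiagonal of sum `s` ends in `(0, s)`, and the step after that starts the following one.
  corner : ∀ s → ∃[ n ] unpair n ≡ (s , 0)
  corner zero    = 0 , refl
  corner (suc s)
    with n , eq ← along s 0 (subst (λ t → ∃[ n ] unpair n ≡ (t , 0)) (sym (+-identityʳ s)) (corner s)) =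
    suc n , cong next eq

unpair-surjective : ∀ a b → ∃[ n ] unpair n ≡ (a , b)
unpair-surjective a b = along b a (corner (b + a))

opaque
  pair : ℕ → ℕ → ℕ
  pair a b = proj₁ (unpair-surjective a b)

  pair-injective : ∀ {a b c d} → pair a b ≡ pair c d → a ≡ c × b ≡ d
  pair-injective {a} {b} {c} {d} eq = ,-injective
    (trans (sym (proj₂ (unpair-surjective a b)))
           (trans (cong unpair eq) (proj₂ (unpair-surjective c d))))

opaque
  tuple : ∀ n → (Fin n → ℕ) → ℕ
  tuple zero    f = 0
  tuple (suc n) f = pair (f zero) (tuple n (f ∘ suc))

  tuple-injective : ∀ n {f g} → tuple n f ≡ tuple n g → ∀ i → f i ≡ g i
  tuple-injective (suc n) eq zero    = proj₁ (pair-injective eq)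
  tuple-injective (suc n) eq (suc i) = tuple-injective n (proj₂ (pair-injective eq)) i

-- Uniform bounds over finite lists

list-bound : ∀ {X : Set} {P : X → ℕ → Set} →
  (∀ {x m n} → m ≤ⁿ n → P x m → P x n) →
  (l : List X) → (∀ {x} → x ∈ˡ l → ∃[ n ] P x n) → ∃[ n ] (∀ {x} → x ∈ˡ l → P x n)
list-bound mono []      h = 0 , λ ()
list-bound mono (x ∷ l) h
  with m , p ← h (here refl) | n , q ← list-bound mono l (h ∘ there) =
  m ⊔ n , λ { (here refl) → mono (m≤m⊔n m n) p ; (there x∈l) → mono (m≤n⊔m m n) (q x∈l) }

finite⇒bounded : ∀ {S} → Finite S → ∃[ n ] (∀ {k} → k ∈ S → k <ⁿ n)
finite⇒bounded (l , S⊆l) = suc (max 0 l) , λ k∈S → s≤s (lookupᴬ (xs≤max 0 l) (S⊆l k∈S))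

-- The Brouwer tree lim f denotes the supremum of the successors of the f n;
-- classically, the trees modulo mutual ≤ form ω₁.

data Ord : Set where
  zero : Ord
  lim  : (ℕ → Ord) → Ord

infix 4 _≤_ _<_

mutual
  data _≤_ : Ord → Ord → Set where
    zero≤ : ∀ {y} → zero ≤ y
    lim≤  : ∀ {f y} → (∀ n → f n < y) → lim f ≤ y

  data _<_ : Ord → Ord → Set where
    <lim : ∀ {x g} n → x ≤ g n → x < lim g

≤-refl : ∀ {x} → x ≤ x
≤-refl {zero}  = zero≤
≤-refl {lim f} = lim≤ λ n → <lim n ≤-refl

mutual
  ≤-trans : ∀ {x y z} → x ≤ y → y ≤ z → x ≤ z
  ≤-trans zero≤    q = zero≤
  ≤-trans (lim≤ h) q = lim≤ λ n → <-≤-trans (h n) q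

  <-≤-trans : ∀ {x y z} → x < y → y ≤ z → x < z
  <-≤-trans (<lim n p) (lim≤ h) = ≤-<-trans p (h n)

  ≤-<-trans : ∀ {x y z} → x ≤ y → y < z → x < z
  ≤-<-trans p (<lim n q) = <lim n (≤-trans p q)

<⇒≤ : ∀ {x y} → x < y → x ≤ y
<⇒≤ (<lim n zero≤)    = zero≤
<⇒≤ (<lim n (lim≤ h)) = lim≤ λ m → <lim n (<⇒≤ (h m))

<-trans : ∀ {x y z} → x < y → y < z → x < z
<-trans p q = <-≤-trans p (<⇒≤ q)

-- If `lim g ≤ g n`, then in particular `g n < g n`, so the descent passes to the subtree `g n`.
<-irrefl : ∀ {x} → ¬ (x < x)
<-irrefl (<lim n (lim≤ h)) = <-irrefl (h n)

-- A tree below `x` need not be a subtree of `x`. Accessibility is therefore shown for everything up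
-- to `y` at once, by recursion on `y`.
<-wellFounded : WellFounded _<_
<-wellFounded x = below x ≤-refl
  where
  below : ∀ y {x} → x ≤ y → Acc _<_ x
  strictlyBelow : ∀ y {x} → x < y → Acc _<_ x
  below y x≤y = acc λ z<x → strictlyBelow y (<-≤-trans z<x x≤y)
  strictlyBelow (lim g) (<lim n x≤gn) = below (g n) x≤gn

_≈_ : Ord → Ord → Set
_≈_ = SymInterior _≤_

-- Countability as a union of countably many subsingletons: unlike Countable, it
-- is inherited by countable unions without choosing any codes.

record Covered (S : Setoid 0ℓ 0ℓ) (Z : Pred (Setoid.Carrier S) 0ℓ) : Set₁ where
  constructor cover
  open Setoid S using (Carrier) renaming (_≈_ to _≈ₛ_)
  field
    piece        : ℕ → Pred Carrier 0ℓ
    subsingleton : ∀ n {a b} → a ∈ piece n → b ∈ piece n → a ≈ₛ b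
    covers       : Z ⊆ ⋃ ℕ piece

open Covered

module _ {S : Setoid 0ℓ 0ℓ} where
  open Setoid S using (Carrier) renaming (_≈_ to _≈ₛ_)

  covered-⊆ : ∀ {Y Z} → Y ⊆ Z → Covered S Z → Covered S Y
  covered-⊆ Y⊆Z (cover g sub cov) = cover g sub (cov ∘ Y⊆Z)

  covered-subsingleton : ∀ {Z} → (∀ {a b} → a ∈ Z → b ∈ Z → a ≈ₛ b) → Covered S Z
  covered-subsingleton {Z} sub = cover (λ _ → Z) (λ _ → sub) (0 ,_)

  covered-⋃ : ∀ {Z : ℕ → Pred Carrier 0ℓ} → (∀ n → Covered S (Z n)) → Covered S (⋃ ℕ Z)
  covered-⋃ {Z} c = cover g (λ k → subsingleton (c _) _) cov
    where
    g : ℕ → Pred Carrier 0ℓ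
    g k = piece (c (proj₁ (unpair k))) (proj₂ (unpair k))
    cov : ⋃ ℕ Z ⊆ ⋃ ℕ g
    cov {a} (m , a∈Zm)
      with n , a∈gmn ← covers (c m) a∈Zm
      with k , eq ← unpair-surjective m n =
      k , subst (λ (i , j) → a ∈ piece (c i) j) (sym eq) a∈gmn

  covered-∪ : ∀ {Y Z} → Covered S Y → Covered S Z → Covered S (Y ∪ Z)
  covered-∪ {Y} {Z} cY cZ = covered-⊆ (λ { (inj₁ y) → 0 , y ; (inj₂ z) → 1 , z })
    (covered-⋃ {λ { zero → Y ; (suc _) → Z }} λ { zero → cY ; (suc _) → cZ })

  countable⇒covered : ∀ {Z} → Countable (restrict S Z) → Covered S Z
  countable⇒covered {Z} c = cover
    (λ n a → Σ[ a∈Z ∈ a ∈ Z ] to (a , a∈Z) ≡ n)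
    (λ { n (a∈Z , p) (b∈Z , q) → injective (trans p (sym q)) })
    (λ a∈Z → to (_ , a∈Z) , a∈Z , refl)
    where open Injection c

covered-preimage : ∀ {S T : Setoid 0ℓ 0ℓ} (f : Setoid.Carrier S → Setoid.Carrier T) →
  (∀ {a b} → Setoid._≈_ T (f a) (f b) → Setoid._≈_ S a b) →
  ∀ {Z} → Covered T Z → Covered S (Z ∘ f)
covered-preimage f inj (cover g sub cov) =
  cover (λ n → g n ∘ f) (λ n p q → inj (sub n p q)) cov

-- Classical choice and countability

module Classical (em₁ : ExcludedMiddle (lsuc 0ℓ)) (ext : Extensionality 0ℓ 0ℓ) where

  em : ExcludedMiddle 0ℓ
  em = map′ lower lift em₁

  dne₁ : ∀ {P : Set₁} → ¬ ¬ P → P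
  dne₁ = decidable-stable em₁

  -- Excluded middle for all types is a global choice operator. Passing through
  -- Boolean predicates makes it extensional.
  εᵇ : ∀ {A : Set} → A → (A → Bool) → A
  εᵇ d b with em {∃[ a ] b a ≡ true}
  ... | yes (a , _) = a
  ... | no _        = d

  ε : ∀ {A : Set} → A → Pred A 0ℓ → A
  ε d P = εᵇ d (λ a → does (em {P a}))

  does-true : ∀ {P : Set} (P? : Dec P) → does P? ≡ true → P
  does-true (yes p) refl = p

  ε-∈ : ∀ {A : Set} d {P : Pred A 0ℓ} {a} → a ∈ P → ε d P ∈ P
  ε-∈ d {P} {a} p with em {∃[ a ] does (em {P a}) ≡ true}
  ... | yes (_ , eq) = does-true em eq
  ... | no ∄         = contradiction (a , dec-true em p) ∄

  -- Equivalent predicates have the same Boolean characteristic function, by extensionality, and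
  -- `εᵇ` sees nothing else.
  ε-cong : ∀ {A : Set} d {P Q : Pred A 0ℓ} → P ≐ Q → ε d P ≡ ε d Q
  ε-cong d (f , g) = cong (εᵇ d) (ext λ a → does-⇔ (mk⇔ f g) em em)

  covered⇒countable : ∀ {S Z} → Covered S Z → Countable (restrict S Z)
  covered⇒countable {S} {Z} (cover g sub cov) = record
    { to        = code ∘ proj₁
    ; cong      = λ a≈b → ε-cong 0
        ( (λ (c , c≈a , h) → c , S.trans c≈a a≈b , h)
        , (λ (c , c≈b , h) → c , S.trans c≈b (S.sym a≈b) , h))
    ; injective = λ { {a , a∈Z} {b , b∈Z} eq → inj a∈Z b∈Z eq }
    }
    where
    module S = Setoid S
    -- The pieces need not respect the equality of `S`. Closing them under it gives equal elements
    -- equivalent predicates, hence equal codes.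
    Code : S.Carrier → Pred ℕ 0ℓ
    Code a n = ∃[ c ] c S.≈ a × c ∈ g n
    code : S.Carrier → ℕ
    code a = ε 0 (Code a)
    code-∈ : ∀ {a} → a ∈ Z → Code a (code a)
    code-∈ a∈Z with n , h ← cov a∈Z = ε-∈ 0 {Code _} (_ , S.refl , h)
    inj : ∀ {a b} → a ∈ Z → b ∈ Z → code a ≡ code b → a S.≈ b
    inj {a} {b} a∈Z b∈Z eq
      with c , c≈a , h ← code-∈ a∈Z | d , d≈b , k ← code-∈ b∈Z =
      S.trans (S.sym c≈a) (S.trans (sub _ h (subst (λ n → d ∈ g n) (sym eq) k)) d≈b)

  countable-setoid : ∀ {S} → Covered S U → Countable S
  countable-setoid c = record
    { to = to ∘ (_, tt) ; cong = cong′ ; injective = injective }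
    where open Injection (covered⇒countable c) renaming (cong to cong′)

  -- The first uncountable ordinal

  -- The recursion exchanges the two sides: when no `f n` is above `y`, comparing `y` with `f n`
  -- leaves only `f n < y`.
  ≤-or-> : ∀ x y → x ≤ y ⊎ y < x
  ≤-or-> zero    y = inj₁ zero≤
  ≤-or-> (lim f) y with em {∃[ n ] y ≤ f n}
  ... | yes (n , y≤fn) = inj₂ (<lim n y≤fn)
  ... | no ∄           = inj₁ (lim≤ λ n → f< n (≤-or-> y (f n)))
    where
    f< : ∀ n → y ≤ f n ⊎ f n < y → f n < y
    f< n (inj₁ y≤fn) = contradiction (n , y≤fn) ∄
    f< n (inj₂ fn<y) = fn<y

  ω₁ : StrictTotalOrder 0ℓ 0ℓ 0ℓ
  ω₁ = record
    { Carrier = Ord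
    ; _≈_     = _≈_
    ; _<_     = _<_
    ; isStrictTotalOrder = record
      { isStrictPartialOrder = record
        { isEquivalence = Sym.isEquivalence ≤-refl ≤-trans
        ; irrefl        = λ (_ , y≤x) x<y → <-irrefl (<-≤-trans x<y y≤x)
        ; trans         = <-trans
        ; <-resp-≈      = (λ (x≤y , _) z<x → <-≤-trans z<x x≤y)
                        , (λ (_ , y≤x) x<z → ≤-<-trans y≤x x<z)
        }
      ; compare = compare
      }
    }
    where
    compare : ∀ x y → _
    compare x y with ≤-or-> x y | ≤-or-> y x
    ... | inj₁ x≤y | inj₁ y≤x = tri≈ (λ x<y → <-irrefl (<-≤-trans x<y y≤x)) (x≤y , y≤x)
                                     (λ y<x → <-irrefl (<-≤-trans y<x x≤y))
    ... | _        | inj₂ x<y = tri< x<y (λ (_ , y≤x) → <-irrefl (<-≤-trans x<y y≤x))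
                                     (<-irrefl ∘ <-trans x<y)
    ... | inj₂ y<x | _        = tri> (<-irrefl ∘ <-trans y<x)
                                     (λ (x≤y , _) → <-irrefl (<-≤-trans y<x x≤y)) y<x

  Ordₛ : Setoid 0ℓ 0ℓ
  Ordₛ = StrictTotalOrder.Eq.setoid ω₁

  -- Whatever is below `lim g` is below some `g n` or equal to it, so the segment is a countable
  -- union of countable sets.
  segment-covered : ∀ y → Covered Ordₛ (_< y)
  segment-covered zero    = covered-subsingleton λ ()
  segment-covered (lim g) = covered-⊆ split (covered-⋃ λ n →
      covered-∪ (segment-covered (g n))
                (covered-subsingleton {Z = _≈ g n} λ p q → Sym.transitive ≤-trans p (Sym.symmetric q)))
    where
    split : (_< lim g) ⊆ ⋃ ℕ λ n → (_< g n) ∪ (_≈ g n)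
    split {x} (<lim n x≤gn) with ≤-or-> (g n) x
    ... | inj₁ gn≤x = n , inj₂ (x≤gn , gn≤x)
    ... | inj₂ x<gn = n , inj₁ x<gn

  -- Choosing an ordinal for each code gives a sequence `g` that reaches every ordinal up to `≈`.
  -- Its strict upper bound `top = lim g` would equal one of its terms.
  ω₁-uncountable : ¬ Countable Ordₛ
  ω₁-uncountable c = <-irrefl (<lim (to top) (Sym.lhs≤rhs (injective {top} {g (to top)} (sym g-section))))
    where
    open Injection c
    g : ℕ → Ord
    g n = ε zero (λ x → to x ≡ n)
    top : Ord
    top = lim g
    g-section : to (g (to top)) ≡ to top
    g-section = ε-∈ zero {λ x → to x ≡ to top} refl

  isOmega₁ : IsOmega₁ ω₁
  isOmega₁ = record
    { wellFounded       = <-wellFounded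
    ; uncountable       = ω₁-uncountable
    ; segment-countable = covered⇒countable ∘ segment-covered
    }

  -- Embedding ω₁ into an uncountable set

  module Embedding {A : Set} (uncountable : ¬ Covered (setoid A) U) where

    fresh : ∀ {Z} → Covered (setoid A) Z → ∃[ a ] a ∉ Z
    fresh {Z} c = decidable-stable em λ ∄ →
      uncountable (covered-⊆ (λ {a} _ → decidable-stable em λ a∉Z → ∄ (a , a∉Z)) c)

    pick : Pred A 0ℓ → A
    -- `ε` asks for a default; an element outside the empty set serves.
    pick Z = ε (proj₁ (fresh (covered-subsingleton {Z = λ _ → ⊥} λ ()))) (∁ Z)

    -- The values of `embed` strictly below an ordinal. `embed` is unfolded here so that the
    -- transfinite recursion is structural on trees.
    initial : Ord → Pred A 0ℓ
    initial zero    = λ _ → ⊥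
    initial (lim f) = ⋃ ℕ λ n → initial (f n) ∪ (_≡ pick (initial (f n)))

    embed : Ord → A
    embed x = pick (initial x)

    initial-covered : ∀ x → Covered (setoid A) (initial x)
    initial-covered zero    = covered-subsingleton λ ()
    initial-covered (lim f) = covered-⋃ λ n → covered-∪ (initial-covered (f n))
      (covered-subsingleton λ p q → trans p (sym q))

    embed-∉ : ∀ x → embed x ∉ initial x
    embed-∉ x = ε-∈ _ {∁ (initial x)} (proj₂ (fresh (initial-covered x)))

    pick-cong : ∀ {Y Z} → Y ⊆ Z → Z ⊆ Y → pick Y ≡ pick Z
    pick-cong Y⊆Z Z⊆Y = ε-cong _ ((λ ¬y z → ¬y (Z⊆Y z)) , (λ ¬z y → ¬z (Y⊆Z y)))

    mutual
      initial-mono : ∀ x y → x ≤ y → initial x ⊆ initial y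
      initial-mono (lim f) y (lim≤ h) (n , inj₁ a∈) = initial-mono-< (f n) y (h n) a∈
      initial-mono (lim f) y (lim≤ h) (n , inj₂ refl) = embed-∈ (f n) y (h n)

      initial-mono-< : ∀ x y → x < y → initial x ⊆ initial y
      initial-mono-< x (lim g) (<lim n x≤gn) a∈ = n , inj₁ (initial-mono x (g n) x≤gn a∈)

      -- When `x` and `g n` are different trees for one ordinal, their initial sets agree, and
      -- extensionality of the choice makes `embed x` the element adjoined at `n`.
      embed-∈ : ∀ x y → x < y → embed x ∈ initial y
      embed-∈ x (lim g) (<lim n x≤gn) with ≤-or-> (g n) x
      ... | inj₂ x<gn = n , inj₁ (embed-∈ x (g n) x<gn)
      ... | inj₁ gn≤x = n , inj₂ (pick-cong (initial-mono x (g n) x≤gn) (initial-mono (g n) x gn≤x))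

    embed-cong : ∀ {x y} → x ≈ y → embed x ≡ embed y
    embed-cong {x} {y} (x≤y , y≤x) = pick-cong (initial-mono x y x≤y) (initial-mono y x y≤x)

    embed-injective : ∀ {x y} → embed x ≡ embed y → x ≈ y
    embed-injective {x} {y} eq with StrictTotalOrder.compare ω₁ x y
    ... | tri< x<y _ _ = contradiction (subst (_∈ initial y) eq (embed-∈ x y x<y)) (embed-∉ y)
    ... | tri≈ _ x≈y _ = x≈y
    ... | tri> _ _ y<x = contradiction (subst (_∈ initial x) (sym eq) (embed-∈ y x y<x)) (embed-∉ x)

    range-uncountable : ¬ Covered (setoid A) (λ a → ∃[ x ] embed x ≡ a)
    range-uncountable c = ω₁-uncountable (countable-setoid
      (covered-⊆ (λ {x} _ → x , refl) (covered-preimage embed embed-injective c)))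

  -- Cutting a family into uncountable pieces

  module Family (𝒜 : AlmostDisjointFamily) where
    open AlmostDisjointFamily 𝒜
    private Indexₛ = setoid Index

    -- One inclusion suffices: for distinct members it would make the infinite `set i` equal to a
    -- finite intersection.
    members-extensional : ∀ {i j} → (∀ k → k ∈ set i → k ∈ set j) → i ≡ j
    members-extensional {i} {j} i⊆j = decidable-stable em λ i≢j →
      let l , h = almost-disjoint i≢j in infinite i (l , λ k∈i → h (k∈i , i⊆j _ k∈i))

    Containing Omitting : ℕ → Pred Index 0ℓ
    Containing k i = k ∈ set i
    Omitting   k i = k ∉ set i

    -- Otherwise each `k` has a countable side. Removing these countably many sides leaves members
    -- that agree at every `k`, hence at most one, and `Z` would be countable.
    split : ∀ {Z} → ¬ Covered Indexₛ Z →
      ∃[ k ] ¬ Covered Indexₛ (Z ∩ Containing k) × ¬ Covered Indexₛ (Z ∩ Omitting k)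
    -- `Covered` lives in `Set₁`, hence excluded middle one level up.
    split {Z} ¬c = dne₁ λ ∄ → ¬c (covered ∄)
      where
      module _ (∄ : ¬ (∃[ k ] ¬ Covered Indexₛ (Z ∩ Containing k) ×
                              ¬ Covered Indexₛ (Z ∩ Omitting k))) where

        side : ∀ k → Σ[ H ∈ Pred Index 0ℓ ] Covered Indexₛ (Z ∩ H) ×
                     (∀ {i j} → i ∉ H → j ∉ H → k ∈ set i → k ∈ set j)
        side k with em₁ {Covered Indexₛ (Z ∩ Containing k)}
                  | em₁ {Covered Indexₛ (Z ∩ Omitting k)}
        ... | yes c | _     = Containing k , c , λ i∉ j∉ k∈i → contradiction k∈i i∉
        ... | no _  | yes c = Omitting k , c , λ i∉ j∉ k∈i → decidable-stable em j∉
        ... | no ¬c | no ¬d = contradiction (k , ¬c , ¬d) ∄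

        small : ℕ → Pred Index 0ℓ
        small k = Z ∩ proj₁ (side k)

        rest : Pred Index 0ℓ
        rest = Z ∩ ∁ (⋃ ℕ small)

        rest-⊆ : ∀ {i j} → i ∈ rest → j ∈ rest → ∀ k → k ∈ set i → k ∈ set j
        rest-⊆ (i∈Z , i∉) (j∈Z , j∉) k =
          proj₂ (proj₂ (side k)) (λ h → i∉ (k , i∈Z , h)) (λ h → j∉ (k , j∈Z , h))

        covered : Covered Indexₛ Z
        covered = covered-⊆ cases (covered-∪ (covered-⋃ {Z = small} (proj₁ ∘ proj₂ ∘ side))
            (covered-subsingleton {Z = rest} λ p q → members-extensional (rest-⊆ p q)))
          where
          cases : Z ⊆ ⋃ ℕ small ∪ rest
          cases {i} i∈Z with em {i ∈ ⋃ ℕ small}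
          ... | yes h = inj₁ h
          ... | no ¬h = inj₂ (i∈Z , ¬h)

    -- A first cut by `k`, then a cut by `m` of the half containing `k`. The colouring is total, so
    -- that conditions may mention members outside `Z`.
    trisect : ∀ {Z} → ¬ Covered Indexₛ Z →
      Σ[ c ∈ (Index → Fin 3) ] (∀ i → ¬ Covered Indexₛ (Z ∩ λ a → c a ≡ i))
    trisect {Z} ¬cZ
      with k , ¬c∈ , ¬c∉ ← split ¬cZ
      with m , ¬c∈∈ , ¬c∈∉ ← split ¬c∈ = c , uncountable
      where
      c : Index → Fin 3
      c a with em {k ∈ set a} | em {m ∈ set a}
      ... | no _  | _     = zero
      ... | yes _ | yes _ = suc zero
      ... | yes _ | no _  = suc (suc zero)
      c₀ : ∀ {a} → k ∉ set a → c a ≡ zero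
      c₀ {a} k∉ with em {k ∈ set a} | em {m ∈ set a}
      ... | no _   | _ = refl
      ... | yes k∈ | _ = contradiction k∈ k∉
      c₁ : ∀ {a} → k ∈ set a → m ∈ set a → c a ≡ suc zero
      c₁ {a} k∈ m∈ with em {k ∈ set a} | em {m ∈ set a}
      ... | no k∉ | _     = contradiction k∈ k∉
      ... | yes _ | yes _ = refl
      ... | yes _ | no m∉ = contradiction m∈ m∉
      c₂ : ∀ {a} → k ∈ set a → m ∉ set a → c a ≡ suc (suc zero)
      c₂ {a} k∈ m∉ with em {k ∈ set a} | em {m ∈ set a}
      ... | no k∉ | _      = contradiction k∈ k∉
      ... | yes _ | yes m∈ = contradiction m∈ m∉
      ... | yes _ | no _   = refl
      uncountable : ∀ i → ¬ Covered Indexₛ (Z ∩ λ a → c a ≡ i)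
      uncountable zero cov = ¬c∉ (covered-⊆ (λ (z , k∉) → z , c₀ k∉) cov)
      uncountable (suc zero) cov = ¬c∈∈ (covered-⊆ (λ ((z , k∈) , m∈) → z , c₁ k∈ m∈) cov)
      uncountable (suc (suc zero)) cov = ¬c∈∉ (covered-⊆ (λ ((z , k∈) , m∉) → z , c₂ k∈ m∉) cov)

    index-uncountable : ¬ Countable (setoid (ΨPoint 𝒜)) → ¬ Covered Indexₛ U
    index-uncountable ¬c (cover g sub cov) = ¬c (countable-setoid
      (covered-⊆ cases (covered-⋃ λ n → covered-∪ (isolated n) (limit n))))
      where
      Isolated Limit : ℕ → Pred (ΨPoint 𝒜) 0ℓ
      Isolated n y = y ≡ inj₁ n
      Limit n y = ∃[ a ] y ≡ inj₂ a × a ∈ g n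
      isolated : ∀ n → Covered (setoid (ΨPoint 𝒜)) (Isolated n)
      isolated n = covered-subsingleton λ p q → trans p (sym q)
      limit : ∀ n → Covered (setoid (ΨPoint 𝒜)) (Limit n)
      limit n = covered-subsingleton λ { (a , refl , p) (b , refl , q) → cong inj₂ (sub n p q) }
      cases : U ⊆ ⋃ ℕ (λ n → Isolated n ∪ Limit n)
      cases {inj₁ n} _ = n , inj₁ refl
      cases {inj₂ a} _ with n , h ← cov {a} _ = n , inj₂ (a , refl , h)

    -- The forcing order, its σ-linkedness and its dense sets

    module Forcing (c : Index → Fin 3) where

      -- The natural numbers that the promises in `l` force into the open set of colour `i`.
      Trace : List (Index × ℕ) → Fin 3 → Pred ℕ 0ℓ
      Trace l i k = ∃[ a ] ∃[ m ] (a , m) ∈ˡ l × c a ≡ i × k ∈ set a × m ≤ⁿ k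

      Good : List (Index × ℕ) → Set
      Good l = Empty (⋂ (Fin 3) (Trace l))

      Trace-mono : ∀ {l l′} → (∀ {x} → x ∈ˡ l → x ∈ˡ l′) → ∀ {i} → Trace l i ⊆ Trace l′ i
      Trace-mono l⊆l′ (a , m , am∈ , rest) = a , m , l⊆l′ am∈ , rest

      Condition : Set
      Condition = Σ (List (Index × ℕ)) Good

      _≼_ : Condition → Condition → Set
      (q , _) ≼ (p , _) = ∀ {x} → x ∈ˡ p → x ∈ˡ q

      -- Lists stand for finite sets, and inclusion of lists is only a preorder; mutual inclusion is
      -- taken as equality.
      ℙ : Poset 0ℓ 0ℓ 0ℓ
      ℙ = Sym.poset {R = _≼_} id (λ q≼p r≼q → q≼p ∘ r≼q)

      -- Distinctness is part of the predicate so that every pair of entries has a bound, repeated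
      -- members included.
      MeetBelow : Index → Index → ℕ → Set
      MeetBelow a b n = a ≢ b → ∀ {k} → k ∈ set a → k ∈ set b → k <ⁿ n

      MeetBelow-mono : ∀ {a b m n} → m ≤ⁿ n → MeetBelow a b m → MeetBelow a b n
      MeetBelow-mono m≤n h a≢b k∈a k∈b = ≤ⁿ-trans (h a≢b k∈a k∈b) m≤n

      meet-bound : ∀ a b → ∃[ n ] MeetBelow a b n
      meet-bound a b with em {a ≡ b}
      ... | yes a≡b = 0 , λ a≢b → contradiction a≡b a≢b
      ... | no a≢b  with n , h ← finite⇒bounded (almost-disjoint a≢b) = n , λ _ k∈a k∈b → h (k∈a , k∈b)

      meets-bound : ∀ a (l : List (Index × ℕ)) →
        ∃[ n ] (∀ {x} → x ∈ˡ l → MeetBelow a (proj₁ x) n)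
      meets-bound a l = list-bound {P = λ x → MeetBelow a (proj₁ x)} MeetBelow-mono l
        (λ {x} _ → meet-bound a (proj₁ x))

      allMeets-bound : ∀ (l : List (Index × ℕ)) →
        ∃[ n ] (∀ {y} → y ∈ˡ l → ∀ {x} → x ∈ˡ l → MeetBelow (proj₁ y) (proj₁ x) n)
      allMeets-bound l = list-bound {P = λ y n → ∀ {x} → x ∈ˡ l → MeetBelow (proj₁ y) (proj₁ x) n}
        (λ m≤n h x∈l → MeetBelow-mono m≤n (h x∈l)) l
        (λ {y} _ → meets-bound (proj₁ y) l)

      bound : List (Index × ℕ) → ℕ
      bound l = proj₁ (allMeets-bound l)

      -- Members of different colours are different, so a common element lies below the bound on
      -- their intersection.
      two-traces : ∀ l {i j k} → i ≢ j → k ∈ Trace l i → k ∈ Trace l j → k <ⁿ bound l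
      two-traces l i≢j (a , m , am∈ , refl , k∈a , _) (b , n , bn∈ , refl , k∈b , _) =
        proj₂ (allMeets-bound l) am∈ bn∈ (λ a≡b → i≢j (cong c a≡b)) k∈a k∈b

      bit : Set → ℕ
      bit P = if does (em {P}) then 1 else 0

      bit-injective : ∀ {P Q} → bit P ≡ bit Q → P → Q
      bit-injective {P} {Q} eq p = does-true em
        (1≡if (trans (cong (if_then 1 else 0) (sym (dec-true (em {P}) p))) eq))
        where
        1≡if : ∀ {b} → 1 ≡ (if b then 1 else 0) → b ≡ true
        1≡if {true} _ = refl

      row : List (Index × ℕ) → Fin 3 → ∀ {n} → Fin n → ℕ
      row l i k = bit (toℕ k ∈ Trace l i)

      traceCode : List (Index × ℕ) → ℕ → ℕ
      traceCode l n = tuple 3 λ i → tuple n (row l i)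

      -- The fibres of `colour` are the linked sets. Each trace code is taken at the list's own
      -- bound, which is why the bound is recorded too.
      colour : List (Index × ℕ) → ℕ
      colour l = pair (bound l) (traceCode l (bound l))

      traceCode-injective : ∀ {l l′ n} → traceCode l n ≡ traceCode l′ n →
        ∀ {i k} → k <ⁿ n → k ∈ Trace l i → k ∈ Trace l′ i
      traceCode-injective {l} {l′} {n} eq {i} {k} k<n h =
        subst (_∈ Trace l′ i) (toℕ-fromℕ< k<n)
          (bit-injective (tuple-injective n (tuple-injective 3 eq i) (fromℕ< k<n))
            (subst (_∈ Trace l i) (sym (toℕ-fromℕ< k<n)) h))

      linked : ∀ {p q} → colour (proj₁ p) ≡ colour (proj₁ q) → Compatible ℙ p q
      linked {l , good} {l′ , good′} eq = (l ++ l′ , good-++) , ∈-++⁺ˡ , ∈-++⁺ʳ l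
        where
        equal : bound l ≡ bound l′ × traceCode l (bound l) ≡ traceCode l′ (bound l′)
        equal = pair-injective eq
        bounds : bound l ≡ bound l′
        bounds = proj₁ equal
        codes : traceCode l′ (bound l) ≡ traceCode l (bound l)
        codes = trans (cong (traceCode l′) bounds) (sym (proj₂ equal))

        cases : ∀ {i} → Trace (l ++ l′) i ⊆ Trace l i ∪ Trace l′ i
        cases (a , m , am∈ , rest) =
          Sum.map (λ h → a , m , h , rest) (λ h → a , m , h , rest) (∈-++⁻ l am∈)

        below : ∀ {k} → k <ⁿ bound l → ∀ {i} → k ∈ Trace (l ++ l′) i → k ∈ Trace l i
        below k<n h = Sum.[ id , traceCode-injective codes k<n ] (cases h)

        doubled : ∀ {k i j} → i ≢ j →
          (k ∈ Trace l i × k ∈ Trace l j) ⊎ (k ∈ Trace l′ i × k ∈ Trace l′ j) → k <ⁿ bound l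
        doubled i≢j (inj₁ (h , h′)) = two-traces l i≢j h h′
        doubled i≢j (inj₂ (h , h′)) = subst (_ <ⁿ_) (sym bounds) (two-traces l′ i≢j h h′)

        -- Three colours are served by two lists, so one list serves two of them and `two-traces`
        -- applies to it.
        pigeonhole : ∀ {k} → (∀ i → k ∈ Trace l i ⊎ k ∈ Trace l′ i) → k <ⁿ bound l
        pigeonhole f with f zero | f (suc zero) | f (suc (suc zero))
        ... | inj₁ x | inj₁ y | _      = doubled {i = zero} {suc zero} (λ ()) (inj₁ (x , y))
        ... | inj₂ x | inj₂ y | _      = doubled {i = zero} {suc zero} (λ ()) (inj₂ (x , y))
        ... | inj₁ x | inj₂ _ | inj₁ z = doubled {i = zero} {suc (suc zero)} (λ ()) (inj₁ (x , z))
        ... | inj₂ x | inj₁ _ | inj₂ z = doubled {i = zero} {suc (suc zero)} (λ ()) (inj₂ (x , z))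
        ... | inj₁ _ | inj₂ y | inj₂ z = doubled {i = suc zero} {suc (suc zero)} (λ ()) (inj₂ (y , z))
        ... | inj₂ _ | inj₁ y | inj₁ z = doubled {i = suc zero} {suc (suc zero)} (λ ()) (inj₁ (y , z))

        good-++ : Good (l ++ l′)
        -- Below the common bound the traces of the union are those of `l`, so `k` would already
        -- violate the goodness of `l`.
        good-++ k h = good k λ i → below (pigeonhole (cases ∘ h)) (h i)

      σ-linked : σ-Linked ℙ
      σ-linked = (λ n p → colour (proj₁ p) ≡ n)
               , (λ n {p} {q} p∈ q∈ → linked {p} {q} (trans p∈ (sym q∈)))
               , (λ {p} _ → colour (proj₁ p) , refl)

      Decides : Index → Pred Condition 0ℓ
      Decides a (l , _) = ∃[ m ] (a , m) ∈ˡ l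

      other : Fin 3 → Fin 3
      other zero    = suc zero
      other (suc _) = zero

      other-≢ : ∀ i → i ≢ other i
      other-≢ zero    ()
      other-≢ (suc _) ()

      -- The new promise starts above every intersection of `a` with another member in `l`. Were it
      -- to put `k` into its colour, a second colour would have `k` from an old entry, in a
      -- different member, forcing `k < m`. So it creates no triple intersection.
      dense : ∀ a → Dense ℙ (Decides a)
      dense a (l , good) = ((a , m) ∷ l , good′) , there , m , here refl
        where
        m : ℕ
        m = proj₁ (meets-bound a l)
        new-or-old : ∀ {i k} → k ∈ Trace ((a , m) ∷ l) i →
          (c a ≡ i × k ∈ set a × m ≤ⁿ k) ⊎ k ∈ Trace l i
        new-or-old (_ , _ , here refl , rest) = inj₁ rest
        new-or-old (b , n , there bn∈ , rest) = inj₂ (b , n , bn∈ , rest)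
        old : ∀ {k} → (∀ i → k ∈ Trace ((a , m) ∷ l) i) → ∀ i → k ∈ Trace l i
        old h i with new-or-old (h i)
        ... | inj₂ t = t
        ... | inj₁ (refl , k∈a , m≤k) with new-or-old (h (other (c a)))
        ...   | inj₁ (eq , _) = contradiction eq (other-≢ (c a))
        ...   | inj₂ (b , n , bn∈ , cb≡ , k∈b , _) = contradiction m≤k (<⇒≱
                  (proj₂ (meets-bound a l) bn∈ (λ a≡b → other-≢ (c a) (trans (cong c a≡b) cb≡)) k∈a k∈b))
        good′ : Good ((a , m) ∷ l)
        good′ k h = good k (old h)

      -- Open sets from a generic filter

      module Generic {G : Pred Condition 0ℓ} (filter : IsFilter ℙ G) where
        open IsFilter filter

        Uᴳ : Fin 3 → Pred (ΨPoint 𝒜) 0ℓ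
        Uᴳ i (inj₁ k) = ∃[ p ] p ∈ G × k ∈ Trace (proj₁ p) i
        Uᴳ i (inj₂ a) = c a ≡ i × (∃[ p ] p ∈ G × p ∈ Decides a)

        Uᴳ-open : ∀ i → ΨOpen 𝒜 (Uᴳ i)
        Uᴳ-open i {inj₁ k} h = 0 , λ { refl → h }
        -- The promise `(a , m)` itself gives the neighbourhood: the elements of `set a` from `m` on
        -- are in the trace of the same `p`.
        Uᴳ-open i {inj₂ a} h@(ca≡i , p , p∈G , m , am∈) = m , λ
          { (inj₁ refl) → h
          ; (inj₂ (k , refl , k∈a , m≤k)) → p , p∈G , a , m , am∈ , ca≡i , k∈a , m≤k
          }

        -- A limit point has just one colour. For a natural number, directedness gathers the three
        -- witnesses into one condition, whose goodness is contradicted.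
        Uᴳ-empty : Empty (⋂ (Fin 3) Uᴳ)
        Uᴳ-empty (inj₂ a) h with () ← trans (sym (proj₁ (h zero))) (proj₁ (h (suc zero)))
        Uᴳ-empty (inj₁ k) h
          with p₀ , p₀∈ , t₀ ← h zero
             | p₁ , p₁∈ , t₁ ← h (suc zero)
             | p₂ , p₂∈ , t₂ ← h (suc (suc zero))
          with q , q∈ , q≼p₀ , q≼p₁ ← directed p₀∈ p₁∈
          with r , r∈ , r≼q , r≼p₂ ← directed q∈ p₂∈ =
          proj₂ r k λ
            { zero             → Trace-mono (r≼q ∘ q≼p₀) t₀
            ; (suc zero)       → Trace-mono (r≼q ∘ q≼p₁) t₁
            ; (suc (suc zero)) → Trace-mono r≼p₂ t₂
            }

  -- Countable spaces must be excluded: the discrete space ω is Ψ-like, for the empty family, and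
  -- trivially has P₃.
  no-Ψ-like-P₃ : MAω₁[σ-linked] →
    ¬ (Σ[ X ∈ TopologicalSpace ] ¬ CountableSpace X × ΨLike X × P₃ X)
  no-Ψ-like-P₃ ma (X , ¬countable , (𝒜 , homeo) , _ , p₃) =
    -- The countable `V i` contains the limit points of colour `i` in the range of `embed`, and
    -- these are uncountably many.
    uncountable i (covered-⊆ (λ { ((x , refl) , cx≡i) → subst (λ j → from (inj₂ (embed x)) ∈ V j) cx≡i (e∈V x) })
      (covered-preimage (from ∘ inj₂) from-inj₂-injective (countable⇒covered c-V)))
    where
    open AlmostDisjointFamily 𝒜
    open Homeomorphism homeo
    open Inverse bijection using (to; from; strictlyInverseˡ; strictlyInverseʳ)
    open Family 𝒜

    to-injective : ∀ {x y} → to x ≡ to y → x ≡ y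
    to-injective {x} {y} eq =
      trans (sym (strictlyInverseʳ x)) (trans (cong from eq) (strictlyInverseʳ y))

    from-inj₂-injective : ∀ {a b} → from (inj₂ a) ≡ from (inj₂ b) → a ≡ b
    from-inj₂-injective {a} {b} eq = inj₂-injective
      (trans (sym (strictlyInverseˡ (inj₂ a))) (trans (cong to eq) (strictlyInverseˡ (inj₂ b))))

    Ψ-uncountable : ¬ Countable (setoid (ΨPoint 𝒜))
    Ψ-uncountable count = ¬countable (record
      { to        = Injection.to count ∘ to
      ; cong      = cong (Injection.to count ∘ to)
      ; injective = to-injective ∘ Injection.injective count
      })

    open Embedding (index-uncountable Ψ-uncountable)

    -- The cut is made inside the range of `embed`, since only ω₁ many members can be decided by the
    -- filter.
    pieces = trisect range-uncountable
    c = proj₁ pieces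
    uncountable = proj₂ pieces

    open Forcing c

    generic = ma ℙ ([] , λ { k h → case-[] (h zero) }) σ-linked
      Ordₛ (ω₁ , isOmega₁ , record { to = id ; cong = id ; injective = id })
      (Decides ∘ embed)
      -- Trees for the same ordinal index the same member, hence the same dense set.
      (λ {x} {y} x≈y → subst (λ a → Decides (embed x) ≐ Decides a) (embed-cong x≈y) (id , id))
      (dense ∘ embed)
      where
      case-[] : ∀ {k i} → k ∉ Trace [] i
      case-[] (_ , _ , () , _)

    open Generic (proj₁ (proj₂ generic))

    V : Fin 3 → Pred (TopologicalSpace.Point X) 0ℓ
    V i = Uᴳ i ∘ to

    small : ∃[ i ] CountableSubset (V i)
    small = p₃ V (to-continuous ∘ Uᴳ-open) (λ x → Uᴳ-empty (to x))
    i = proj₁ small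
    c-V = proj₂ small

    e∈V : ∀ x → from (inj₂ (embed x)) ∈ V (c (embed x))
    e∈V x = subst (Uᴳ (c (embed x))) (sym (strictlyInverseˡ (inj₂ (embed x))))
      (refl , proj₂ (proj₂ generic) x)

theorem3p1 : ExcludedMiddle (lsuc 0ℓ) → Extensionality 0ℓ 0ℓ →
    MAω₁[σ-linked] →
    ¬ (Σ[ X ∈ TopologicalSpace ] ¬ CountableSpace X × ΨLike X × P₃ X)
theorem3p1 em ext = Classical.no-Ψ-like-P₃ em ext
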